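{- Let $A=\{a_1,a_2,\ldots,a_k\}$ be a set of $k\ge1$ distinct positive integers, let $\tau$ be a permutation of $\{1,2,\ldots,k\}$, and let $A_{\tau(j)}=\{a_{\tau(1)},\ldots,a_{\tau(j)}\}$ for $j=1,\ldots,k$, with $A_{\tau(0)}=\emptyset$. Then the following are equivalent: (a) The elements of $A$ are pairwise co-prime (i.e. every $2$-element subset of $A$ has gcd $1$). (b) \[ 2|A|-1 = \left( 1 + 4 \sum_{d=1}^{\sup A} \mu(d)\, v(A,d)\,(v(A,d)-1) \right)^{1/2}. \] (c) \[ 2|A|-1 = \left( 1 + 8 \sum_{j=1}^k \sum_{d\mid a_{\tau(j)}} \mu(d)\, v(A_{\tau(j-1)},d) \right)^{1/2}. \]
   Context: $\sup A$ is the largest element of $A$. $\mu$ is the Möbius function. For a finite set $X$ of positive integers and a positive integer $d$, $v(X,d)$ is the number of multiples of $d$ in $X$ (so $v(\emptyset,d)=0$). -}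

module Defs where

open import Data.Fin.Base using (Fin)
open import Data.Fin.Permutation using (Permutation′; _⟨$⟩ʳ_)
open import Data.Integer.Base as ℤ using (ℤ; 0ℤ; -1ℤ)
open import Data.List.Base
  using (List; foldr; map; filter; length; take; tabulate; upTo)
open import Data.List.Extrema.Nat using (max)
open import Data.List.Membership.Propositional using (_∈_)
open import Data.List.Relation.Unary.Unique.DecPropositional using (unique?)
open import Data.Nat.Base using (ℕ; zero; suc)
open import Data.Nat.Divisibility using (_∣?_)
open import Data.Nat.GCD using (gcd)
open import Data.Nat.Primality.Factorisation using (factors; factorise)
open import Data.Nat.Properties using (_≟_)
open import Data.Bool.Base using (if_then_else_)
open import Data.Product.Base using (_×_)
open import Function.Base using (_∘_)
open import Relation.Binary.PropositionalEquality using (_≡_; _≢_)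
open import Relation.Nullary.Decidable.Core using (⌊_⌋)

sumOver : {X : Set} → List X → (X → ℤ) → ℤ
sumOver xs f = foldr ℤ._+_ 0ℤ (map f xs)

infix 5 sumOver
syntax sumOver xs (λ x → e) = ∑[ x ← xs ] e

[1⋯_] : ℕ → List ℕ
[1⋯ n ] = map suc (upTo n)

-- Meaningful for n ≥ 1 only: divisors 0 is empty.
divisors : ℕ → List ℕ
divisors n = filter (_∣? n) [1⋯ n ]

-- (-1)^r if n is a product of r distinct primes, and 0 if a prime occurs
-- at least twice in n.  The value at 0 is a dummy.
μ : ℕ → ℤ
μ zero      = 0ℤ
μ n@(suc _) = if ⌊ unique? _≟_ ps ⌋ then -1ℤ ℤ.^ length ps else 0ℤ
  where
  ps : List ℕ
  ps = factors (factorise n)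

-- Finite sets of naturals are represented by lists without repetitions, so
-- that length is cardinality.

∣_∣ : List ℕ → ℕ
∣ X ∣ = length X

v : List ℕ → ℕ → ℕ
v X d = ∣ filter (d ∣?_) X ∣

-- The largest element of a nonempty X (and 0 for the empty list).
sup : List ℕ → ℕ
sup = max 0

PairwiseCoprime : List ℕ → Set
PairwiseCoprime X = ∀ {x y} → x ∈ X → y ∈ X → x ≢ y → gcd x y ≡ 1

module _ {k : ℕ} (a : Fin k → ℕ) where

  -- {a₁, …, a_k}; repetition-free when a is injective.
  setOf : List ℕ
  setOf = tabulate a

  -- {a_τ(1), …, a_τ(j)}, for 0 ≤ j ≤ k.  Fin k starts at 0, so i : Fin k
  -- stands for j = toℕ i + 1, and A_τ(j-1) is prefix τ (toℕ i).
  prefix : Permutation′ k → ℕ → List ℕ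
  prefix τ j = take j (tabulate (a ∘ (τ ⟨$⟩ʳ_)))

-- y = x^{1/2}: y is the nonnegative real whose square is x.  Since y is an
-- integer here, this is a condition within ℤ; it fails for every y when x < 0.
_≡√_ : ℤ → ℤ → Set
y ≡√ x = 0ℤ ℤ.≤ y × y ℤ.* y ≡ x

infix 4 _≡√_

{-# OPTIONS --safe #-}
module Submission where

-- Since ∑_{d ∣ n} μ(d) = [n = 1], the sum ∑_{d ∣ x, d ∣ y} μ(d) is the indicator
-- χ(x,y) of gcd(x,y) = 1.  Expanding v as a sum of divisibility indicators,
-- the double sum in (c) counts the coprime pairs i < j in the order given by τ,
-- and the sum in (b) counts each coprime pair twice, the diagonal terms of v²
-- being cancelled by v.  Both radicands are therefore 1 + 8C with C the number
-- of coprime pairs, while (2k-1)² = 1 + 8k(k-1)/2; equality says that all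
-- k(k-1)/2 pairs are coprime.

open import Defs
import Data.Integer.Properties as ℤₚ
import Data.Nat.Properties as ℕₚ
open import Algebra.Properties.AbelianGroup ℤₚ.+-0-abelianGroup using () renaming (∙-cancelˡ to +-cancelˡ)
open import Data.Bool.Base using (true; false; if_then_else_)
open import Data.Fin.Base using (Fin; toℕ; zero; suc)
open import Data.Fin.Permutation using (Permutation′; _⟨$⟩ʳ_; _⟨$⟩ˡ_; inverseˡ; inverseʳ)
open import Data.Integer.Base using (ℤ; +_; 0ℤ; 1ℤ; -1ℤ; _+_; _-_; _*_; -_; _^_; +≤+)
open import Data.Integer.Tactic.RingSolver using (solve-∀)
open import Data.List.Base
  using (List; []; _∷_; _++_; foldr; map; filter; length; take; tabulate; upTo; allFin)
open import Data.List.Extrema ℕₚ.≤-totalOrder using (xs≤max)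
open import Data.List.Membership.Propositional using (_∈_)
open import Data.List.Membership.Propositional.Properties
  using (∈-filter⁺; ∈-length; ∈-map⁻; ∈-upTo⁻; ∈-tabulate⁺; ∈-tabulate⁻)
open import Data.List.Properties using (filter-none; map-++; map-tabulate; upTo-∷ʳ; length-tabulate)
open import Data.List.Relation.Binary.Permutation.Propositional using (_↭_; ↭-sym; ↭⇒↭ₛ)
open import Data.List.Relation.Binary.Permutation.Propositional.Properties using (↭-length)
import Data.List.Relation.Binary.Permutation.Setoid.Properties as ↭ₛ
open import Data.List.Relation.Unary.All as All using (All; []; _∷_)
import Data.List.Relation.Unary.All.Properties as All
open import Data.List.Relation.Unary.AllPairs using (AllPairs; []; _∷_)
import Data.List.Relation.Unary.AllPairs.Properties as AllPairs
open import Data.List.Relation.Unary.Any using (here; there)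
open import Data.List.Relation.Unary.Unique.DecPropositional ℕₚ._≟_
  using (Unique; unique?)
open import Data.Nat.Base as ℕ
  using (ℕ; _≤_; _<_; zero; suc; z≤n; s≤s; NonZero; >-nonZero)
open import Data.Nat.Coprimality using (Coprime; coprime-divisor)
open import Data.Nat.Divisibility
open import Data.Nat.GCD
open import Data.Nat.ListAction using (product)
open import Data.Nat.ListAction.Properties using (∈⇒∣product)
open import Data.Nat.Primality using (Prime; ¬prime[1]; prime⇒irreducible; prime⇒nonZero; productOfPrimes≢0)
open import Data.Nat.Primality.Factorisation
open PrimeFactorisation using (isFactorisation; factorsPrime)
open import Data.Product.Base using (_×_; _,_; proj₁)
open import Data.Sum.Base using (inj₁; inj₂)
open import Function.Base using (_∘_; id)
open import Function.Bundles using (_⇔_; mk⇔; module Equivalence)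
open import Function.Definitions using (Injective)
open import Relation.Binary.PropositionalEquality
open import Relation.Nullary.Decidable
  using (Dec; yes; no; does; ⌊_⌋; dec-true; dec-false; does-⇔; isYes≗does; decidable-stable; ¬?)
open import Relation.Nullary.Negation using (¬_; contradiction)
open import Relation.Unary using (Pred; Decidable)
open ≡-Reasoning

-- Finite sums

private
  variable
    X : Set
    P Q : Set

-- The value depends on `does` alone, so decisions of equivalent propositions have equal indicators.
𝟙 : Dec P → ℤ
𝟙 P? = if does P? then 1ℤ else 0ℤ

𝟙-true : (P? : Dec P) → P → 𝟙 P? ≡ 1ℤ
𝟙-true P? p = cong (if_then 1ℤ else 0ℤ) (dec-true P? p)

𝟙-false : (P? : Dec P) → ¬ P → 𝟙 P? ≡ 0ℤ
𝟙-false P? ¬p = cong (if_then 1ℤ else 0ℤ) (dec-false P? ¬p)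

𝟙-cong : (P? : Dec P) (Q? : Dec Q) → (P → Q) → (Q → P) → 𝟙 P? ≡ 𝟙 Q?
𝟙-cong P? Q? to from = cong (if_then 1ℤ else 0ℤ) (does-⇔ (mk⇔ to from) P? Q?)

𝟙-idem : (P? : Dec P) → 𝟙 P? * 𝟙 P? ≡ 𝟙 P?
𝟙-idem (yes _) = refl
𝟙-idem (no  _) = refl

∑-cong : (xs : List X) {f g : X → ℤ} → (∀ {x} → x ∈ xs → f x ≡ g x) →
         sumOver xs f ≡ sumOver xs g
∑-cong []       f≗g = refl
∑-cong (x ∷ xs) f≗g = cong₂ _+_ (f≗g (here refl)) (∑-cong xs (f≗g ∘ there))

∑-zero : (xs : List X) → (∑[ x ← xs ] 0ℤ) ≡ 0ℤ
∑-zero []       = refl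
∑-zero (x ∷ xs) = trans (ℤₚ.+-identityˡ _) (∑-zero xs)

∑-vanish : (xs : List X) {f : X → ℤ} → (∀ {x} → x ∈ xs → f x ≡ 0ℤ) → sumOver xs f ≡ 0ℤ
∑-vanish xs f≗0 = trans (∑-cong xs f≗0) (∑-zero xs)

∑-+ : (xs : List X) (f g : X → ℤ) →
      (∑[ x ← xs ] (f x + g x)) ≡ sumOver xs f + sumOver xs g
∑-+ []       f g = refl
∑-+ (x ∷ xs) f g = begin
  f x + g x + (∑[ x ← xs ] (f x + g x))        ≡⟨ cong (_+_ (f x + g x)) (∑-+ xs f g) ⟩
  f x + g x + (sumOver xs f + sumOver xs g)    ≡⟨ interchange (f x) (g x) _ _ ⟩
  f x + sumOver xs f + (g x + sumOver xs g)    ∎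
  where
  interchange : ∀ a b c d → a + b + (c + d) ≡ a + c + (b + d)
  interchange = solve-∀

∑-*ˡ : (xs : List X) (c : ℤ) (f : X → ℤ) → (∑[ x ← xs ] (c * f x)) ≡ c * sumOver xs f
∑-*ˡ []       c f = sym (ℤₚ.*-zeroʳ c)
∑-*ˡ (x ∷ xs) c f = begin
  c * f x + (∑[ x ← xs ] (c * f x))  ≡⟨ cong (_+_ (c * f x)) (∑-*ˡ xs c f) ⟩
  c * f x + c * sumOver xs f         ≡⟨ ℤₚ.*-distribˡ-+ c (f x) _ ⟨
  c * (f x + sumOver xs f)           ∎

∑-++ : (xs ys : List X) (f : X → ℤ) → sumOver (xs ++ ys) f ≡ sumOver xs f + sumOver ys f
∑-++ []       ys f = sym (ℤₚ.+-identityˡ _)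
∑-++ (x ∷ xs) ys f = trans (cong (_+_ (f x)) (∑-++ xs ys f)) (sym (ℤₚ.+-assoc (f x) _ _))

∑-filter : {P : Pred X _} (P? : Decidable P) (xs : List X) (f : X → ℤ) →
           sumOver (filter P? xs) f ≡ (∑[ x ← xs ] (𝟙 (P? x) * f x))
∑-filter P? []       f = refl
∑-filter P? (x ∷ xs) f with does (P? x)
... | true  = cong₂ _+_ (sym (ℤₚ.*-identityˡ (f x))) (∑-filter P? xs f)
... | false = trans (∑-filter P? xs f) (sym (ℤₚ.+-identityˡ _))

-- The tail of `allFin (suc k)` unfolds to `tabulate suc`; this reindexes it over `allFin k`.
∑-tabulate : ∀ {k} (g : Fin k → X) (f : X → ℤ) →
             sumOver (tabulate g) f ≡ (∑[ i ← allFin k ] f (g i))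
∑-tabulate g f = cong (foldr _+_ 0ℤ)
  (trans (map-tabulate g f) (sym (map-tabulate id (f ∘ g))))

-- Sums over ranges, multiples and divisors

∈-[1⋯]⁻ : ∀ {n d} → d ∈ [1⋯ n ] → 0 < d × d ≤ n
∈-[1⋯]⁻ d∈ with _ , i∈ , refl ← ∈-map⁻ suc d∈ = s≤s z≤n , ∈-upTo⁻ i∈

∑-[1⋯suc] : ∀ n (f : ℕ → ℤ) → sumOver [1⋯ suc n ] f ≡ sumOver [1⋯ n ] f + f (suc n)
∑-[1⋯suc] n f = begin
  sumOver [1⋯ suc n ] f                   ≡⟨ cong (λ ds → sumOver (map suc ds) f) (upTo-∷ʳ n) ⟨
  sumOver (map suc (upTo n ++ n ∷ [])) f  ≡⟨ cong (λ ds → sumOver ds f) (map-++ suc (upTo n) _) ⟩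
  sumOver ([1⋯ n ] ++ suc n ∷ []) f       ≡⟨ ∑-++ [1⋯ n ] _ f ⟩
  sumOver [1⋯ n ] f + (f (suc n) + 0ℤ)    ≡⟨ cong (_+_ (sumOver [1⋯ n ] f)) (ℤₚ.+-identityʳ _) ⟩
  sumOver [1⋯ n ] f + f (suc n)           ∎

∑-[1⋯+] : ∀ m n (f : ℕ → ℤ) →
          sumOver [1⋯ m ℕ.+ n ] f ≡ sumOver [1⋯ m ] f + (∑[ i ← [1⋯ n ] ] f (m ℕ.+ i))
∑-[1⋯+] m zero    f rewrite ℕₚ.+-identityʳ m = sym (ℤₚ.+-identityʳ _)
∑-[1⋯+] m (suc n) f rewrite ℕₚ.+-suc m n = begin
  sumOver [1⋯ suc (m ℕ.+ n) ] f
    ≡⟨ ∑-[1⋯suc] (m ℕ.+ n) f ⟩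
  sumOver [1⋯ m ℕ.+ n ] f + f (suc (m ℕ.+ n))
    ≡⟨ cong₂ _+_ (∑-[1⋯+] m n f) (cong f (sym (ℕₚ.+-suc m n))) ⟩
  sumOver [1⋯ m ] f + (∑[ i ← [1⋯ n ] ] f (m ℕ.+ i)) + f (m ℕ.+ suc n)
    ≡⟨ ℤₚ.+-assoc (sumOver [1⋯ m ] f) _ _ ⟩
  sumOver [1⋯ m ] f + ((∑[ i ← [1⋯ n ] ] f (m ℕ.+ i)) + f (m ℕ.+ suc n))
    ≡⟨ cong (_+_ (sumOver [1⋯ m ] f)) (∑-[1⋯suc] n (f ∘ (m ℕ.+_))) ⟨
  sumOver [1⋯ m ] f + (∑[ i ← [1⋯ suc n ] ] f (m ℕ.+ i))  ∎

-- The range is cut into `m` blocks of `p` consecutive numbers; the only multiple of `p` in a block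
-- is its last entry.
∑-multiples : ∀ p .{{_ : NonZero p}} m (f : ℕ → ℤ) →
              (∑[ d ← [1⋯ m ℕ.* p ] ] (𝟙 (p ∣? d) * f d)) ≡ (∑[ e ← [1⋯ m ] ] f (e ℕ.* p))
∑-multiples p         zero    f = refl
∑-multiples p@(suc q) (suc m) f = begin
  sumOver [1⋯ suc m ℕ.* p ] g
    -- `suc m * p` unfolds with `p` in front, but the new block has to be split off at the end.
    ≡⟨ cong (λ n → sumOver [1⋯ n ] g) (ℕₚ.+-comm p (m ℕ.* p)) ⟩
  sumOver [1⋯ m ℕ.* p ℕ.+ p ] g
    ≡⟨ ∑-[1⋯+] (m ℕ.* p) p g ⟩
  sumOver [1⋯ m ℕ.* p ] g + (∑[ i ← [1⋯ suc q ] ] g (m ℕ.* p ℕ.+ i))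
    ≡⟨ cong₂ _+_ (∑-multiples p m f) (∑-[1⋯suc] q (g ∘ (m ℕ.* p ℕ.+_))) ⟩
  F m + ((∑[ i ← [1⋯ q ] ] g (m ℕ.* p ℕ.+ i)) + g (m ℕ.* p ℕ.+ p))
    ≡⟨ cong₂ (λ a b → F m + (a + b)) (∑-vanish [1⋯ q ] nonmultiple) multiple ⟩
  F m + (0ℤ + f (suc m ℕ.* p))
    ≡⟨ cong (_+_ (F m)) (ℤₚ.+-identityˡ _) ⟩
  F m + f (suc m ℕ.* p)
    ≡⟨ ∑-[1⋯suc] m (f ∘ (ℕ._* p)) ⟨
  F (suc m)  ∎
  where
  g : ℕ → ℤ
  g d = 𝟙 (p ∣? d) * f d
  F : ℕ → ℤ
  F m = ∑[ e ← [1⋯ m ] ] f (e ℕ.* p)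
  nonmultiple : ∀ {i} → i ∈ [1⋯ q ] → g (m ℕ.* p ℕ.+ i) ≡ 0ℤ
  nonmultiple {i} i∈ with 0<i , i≤q ← ∈-[1⋯]⁻ i∈ =
    cong (_* f (m ℕ.* p ℕ.+ i)) (𝟙-false (p ∣? _) λ p∣ →
      >⇒∤ {{>-nonZero 0<i}} (s≤s i≤q) (∣m+n∣m⇒∣n p∣ (n∣m*n m)))
  multiple : g (m ℕ.* p ℕ.+ p) ≡ f (suc m ℕ.* p)
  multiple = begin
    g (m ℕ.* p ℕ.+ p)        ≡⟨ cong g (ℕₚ.+-comm (m ℕ.* p) p) ⟩
    g (suc m ℕ.* p)          ≡⟨ cong (_* f (suc m ℕ.* p)) (𝟙-true (p ∣? _) (n∣m*n (suc m))) ⟩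
    1ℤ * f (suc m ℕ.* p)     ≡⟨ ℤₚ.*-identityˡ _ ⟩
    f (suc m ℕ.* p)          ∎

-- No divisor of a nonzero `m` exceeds `m`, so the range can be any `[1⋯ N ]` with `m ≤ N`. Divisor
-- sums of different numbers can thus be compared term by term over one range.
∑-divisors : ∀ {m N} .{{_ : NonZero m}} → m ≤ N → (f : ℕ → ℤ) →
             (∑[ d ← [1⋯ N ] ] (𝟙 (d ∣? m) * f d)) ≡ sumOver (divisors m) f
∑-divisors {m} {N} m≤N f = begin
  sumOver [1⋯ N ] g
    ≡⟨ cong (λ n → sumOver [1⋯ n ] g) (ℕₚ.m+[n∸m]≡n m≤N) ⟨
  sumOver [1⋯ m ℕ.+ (N ℕ.∸ m) ] g
    ≡⟨ ∑-[1⋯+] m (N ℕ.∸ m) g ⟩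
  sumOver [1⋯ m ] g + (∑[ i ← [1⋯ N ℕ.∸ m ] ] g (m ℕ.+ i))
    ≡⟨ cong (_+_ (sumOver [1⋯ m ] g)) (∑-vanish [1⋯ N ℕ.∸ m ] large) ⟩
  sumOver [1⋯ m ] g + 0ℤ
    ≡⟨ ℤₚ.+-identityʳ _ ⟩
  sumOver [1⋯ m ] g
    ≡⟨ ∑-filter (_∣? m) [1⋯ m ] f ⟨
  sumOver (divisors m) f  ∎
  where
  g : ℕ → ℤ
  g d = 𝟙 (d ∣? m) * f d
  large : ∀ {i} → i ∈ [1⋯ N ℕ.∸ m ] → g (m ℕ.+ i) ≡ 0ℤ
  large {i} i∈ = cong (_* f (m ℕ.+ i)) (𝟙-false (m ℕ.+ i ∣? m)
    (>⇒∤ (ℕₚ.m<m+n m (proj₁ (∈-[1⋯]⁻ i∈)))))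

-- The Möbius function

private module ℕ↭ = ↭ₛ (setoid ℕ)

-- The body of `μ` with the prime list as a parameter, so that it can be evaluated at factorisations
-- other than `factorise n`.
möbiusSign : List ℕ → ℤ
möbiusSign ps = if ⌊ unique? ps ⌋ then -1ℤ ^ length ps else 0ℤ

möbiusSign-unique : ∀ {ps} → Unique ps → möbiusSign ps ≡ -1ℤ ^ length ps
möbiusSign-unique {ps} u = cong (if_then -1ℤ ^ length ps else 0ℤ)
  (trans (isYes≗does (unique? ps)) (dec-true (unique? ps) u))

möbiusSign-nonunique : ∀ ps → ¬ Unique ps → möbiusSign ps ≡ 0ℤ
möbiusSign-nonunique ps ¬u = cong (if_then -1ℤ ^ length ps else 0ℤ)
  (trans (isYes≗does (unique? ps)) (dec-false (unique? ps) ¬u))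

möbiusSign-↭ : ∀ {ps qs} → ps ↭ qs → möbiusSign ps ≡ möbiusSign qs
möbiusSign-↭ {ps} {qs} ps↭qs with unique? qs
... | yes u = trans (möbiusSign-unique (ℕ↭.Unique-resp-↭ (↭⇒↭ₛ (↭-sym ps↭qs)) u))
                    (cong (-1ℤ ^_) (↭-length ps↭qs))
... | no ¬u = möbiusSign-nonunique ps (¬u ∘ ℕ↭.Unique-resp-↭ (↭⇒↭ₛ ps↭qs))

möbiusSign-∷-∈ : ∀ {p ps} → p ∈ ps → möbiusSign (p ∷ ps) ≡ 0ℤ
möbiusSign-∷-∈ {p} {ps} p∈ps = möbiusSign-nonunique (p ∷ ps) λ { (p∉ps ∷ _) → All.lookup p∉ps p∈ps refl }

-- A new entry neither creates nor removes a repetition, and it makes the list one longer.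
möbiusSign-∷-∉ : ∀ {p ps} → ¬ p ∈ ps → möbiusSign (p ∷ ps) ≡ - möbiusSign ps
möbiusSign-∷-∉ {p} {ps} p∉ps = cases (unique? ps)
  where
  cases : Dec (Unique ps) → möbiusSign (p ∷ ps) ≡ - möbiusSign ps
  cases (yes u) = begin
    möbiusSign (p ∷ ps)     ≡⟨ möbiusSign-unique (All.¬Any⇒All¬ ps p∉ps ∷ u) ⟩
    -1ℤ * -1ℤ ^ length ps   ≡⟨ ℤₚ.-1*i≡-i _ ⟩
    - (-1ℤ ^ length ps)     ≡⟨ cong -_ (möbiusSign-unique u) ⟨
    - möbiusSign ps         ∎
  cases (no ¬u) = begin
    möbiusSign (p ∷ ps)     ≡⟨ möbiusSign-nonunique (p ∷ ps) (λ { (_ ∷ u) → ¬u u }) ⟩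
    - 0ℤ                    ≡⟨ cong -_ (möbiusSign-nonunique ps ¬u) ⟨
    - möbiusSign ps         ∎

-- Prime factorisations are unique up to order, and `möbiusSign` ignores the order.
μ-factorisation : ∀ {n} .{{_ : NonZero n}} (f : PrimeFactorisation n) → μ n ≡ möbiusSign (factors f)
μ-factorisation {n@(suc _)} f = möbiusSign-↭ (factorisationUnique (factorise n) f)

module _ {p} (p-prime : Prime p) where

  private instance
    p≢0 : NonZero p
    p≢0 = prime⇒nonZero p-prime

  scaleFactorisation : ∀ {n} → PrimeFactorisation n → PrimeFactorisation (n ℕ.* p)
  scaleFactorisation {n} f = record
    { factors         = p ∷ factors f
    ; isFactorisation = trans (ℕₚ.*-comm n p) (cong (p ℕ.*_) (isFactorisation f))
    ; factorsPrime    = p-prime ∷ factorsPrime f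
    }

  -- `p` already occurs among the factors of `n`, so the scaled factorisation repeats it.
  μ-*-prime-∣ : ∀ {n} .{{_ : NonZero n}} → p ∣ n → μ (n ℕ.* p) ≡ 0ℤ
  μ-*-prime-∣ {n} p∣n = trans
    (μ-factorisation {{ℕₚ.m*n≢0 n p}} (scaleFactorisation f))
    (möbiusSign-∷-∈ (factorisationHasAllPrimeFactors p-prime
      (subst (p ∣_) (isFactorisation f) p∣n) (factorsPrime f)))
    where f = factorise n

  μ-*-prime-∤ : ∀ {n} .{{_ : NonZero n}} → p ∤ n → μ (n ℕ.* p) ≡ - μ n
  μ-*-prime-∤ {n} p∤n = begin
    μ (n ℕ.* p)                ≡⟨ μ-factorisation {{ℕₚ.m*n≢0 n p}} (scaleFactorisation f) ⟩
    möbiusSign (p ∷ factors f) ≡⟨ möbiusSign-∷-∉ p∉ ⟩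
    - möbiusSign (factors f)   ≡⟨ cong -_ (μ-factorisation f) ⟨
    - μ n                      ∎
    where
    f = factorise n
    p∉ : ¬ p ∈ factors f
    p∉ p∈ = p∤n (subst (p ∣_) (sym (isFactorisation f)) (∈⇒∣product p∈))

  prime∤⇒coprime : ∀ {d} → p ∤ d → Coprime d p
  prime∤⇒coprime p∤d (c∣d , c∣p) with prime⇒irreducible p-prime c∣p
  ... | inj₁ c≡1  = c≡1
  ... | inj₂ refl = contradiction c∣d p∤d

  -- Pair each divisor d of m p prime to p with d p: the terms cancel, and
  -- multiples of p² contribute nothing.
  ∑-divisors-μ-*-prime : ∀ m .{{_ : NonZero m}} → sumOver (divisors (m ℕ.* p)) μ ≡ 0ℤ
  ∑-divisors-μ-*-prime m = begin
    sumOver (divisors n) μ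
      ≡⟨ ∑-divisors {{ℕₚ.m*n≢0 m p}} ℕₚ.≤-refl μ ⟨
    (∑[ d ← [1⋯ n ] ] (𝟙 (d ∣? n) * μ d))
      ≡⟨ ∑-cong [1⋯ n ] (λ {d} _ → split d) ⟩
    (∑[ d ← [1⋯ n ] ] (𝟙 (d ∣? m) * h d + 𝟙 (p ∣? d) * (𝟙 (d ∣? n) * μ d)))
      ≡⟨ ∑-+ [1⋯ n ] _ _ ⟩
    (∑[ d ← [1⋯ n ] ] (𝟙 (d ∣? m) * h d)) +
    (∑[ d ← [1⋯ n ] ] (𝟙 (p ∣? d) * (𝟙 (d ∣? n) * μ d)))
      -- The first sum shrinks to the divisors of `m`; in the second, `d = e * p`.
      ≡⟨ cong₂ _+_ (∑-divisors (ℕₚ.m≤m*n m p) h) (∑-multiples p m _) ⟩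
    H + (∑[ e ← [1⋯ m ] ] (𝟙 (e ℕ.* p ∣? n) * μ (e ℕ.* p)))
      ≡⟨ cong (_+_ H) (∑-cong [1⋯ m ] cancel) ⟩
    H + (∑[ e ← [1⋯ m ] ] (-1ℤ * (𝟙 (e ∣? m) * h e)))
      ≡⟨ cong (_+_ H) (∑-*ˡ [1⋯ m ] -1ℤ _) ⟩
    H + -1ℤ * (∑[ e ← [1⋯ m ] ] (𝟙 (e ∣? m) * h e))
      ≡⟨ cong (λ s → H + -1ℤ * s) (∑-divisors ℕₚ.≤-refl h) ⟩
    H + -1ℤ * H
      ≡⟨ H-H H ⟩
    0ℤ ∎
    where
    n = m ℕ.* p

    -- `μ` restricted to the numbers prime to `p`.
    h : ℕ → ℤ
    h d = 𝟙 (¬? (p ∣? d)) * μ d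

    H = sumOver (divisors m) h

    H-H : ∀ x → x + -1ℤ * x ≡ 0ℤ
    H-H = solve-∀

    -- If `p ∤ d`, then `d` divides `m * p` exactly when it divides `m`, and the second term is
    -- zero; if `p ∣ d`, the first term is zero.
    split : ∀ d → 𝟙 (d ∣? n) * μ d ≡ 𝟙 (d ∣? m) * h d + 𝟙 (p ∣? d) * (𝟙 (d ∣? n) * μ d)
    split d with p ∣? d
    ... | yes _   = lemma (𝟙 (d ∣? n)) (𝟙 (d ∣? m)) (μ d)
      where
      lemma : ∀ a b c → a * c ≡ b * (0ℤ * c) + 1ℤ * (a * c)
      lemma = solve-∀
    ... | no  p∤d = trans
      (cong (_* μ d) (𝟙-cong (d ∣? n) (d ∣? m)
        (λ d∣n → coprime-divisor (prime∤⇒coprime p∤d) (subst (d ∣_) (ℕₚ.*-comm m p) d∣n))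
        (∣m⇒∣m*n p)))
      (lemma (𝟙 (d ∣? m)) (μ d) (𝟙 (d ∣? n) * μ d))
      where
      lemma : ∀ a b c → a * b ≡ a * (1ℤ * b) + 0ℤ * c
      lemma = solve-∀

    cancel : ∀ {e} → e ∈ [1⋯ m ] →
             𝟙 (e ℕ.* p ∣? n) * μ (e ℕ.* p) ≡ -1ℤ * (𝟙 (e ∣? m) * h e)
    cancel {e} e∈ = trans
      (cong₂ _*_ (𝟙-cong (e ℕ.* p ∣? n) (e ∣? m) (*-cancelʳ-∣ p) (*-monoˡ-∣ p)) μep)
      (lemma (𝟙 (e ∣? m)) (h e))
      where
      instance
        e≢0 : NonZero e
        e≢0 = >-nonZero (proj₁ (∈-[1⋯]⁻ e∈))
      lemma : ∀ a b → a * (-1ℤ * b) ≡ -1ℤ * (a * b)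
      lemma = solve-∀
      -- If `p ∣ e`, both sides are zero, which disposes of the multiples of `p²`.
      μep : μ (e ℕ.* p) ≡ -1ℤ * h e
      μep with p ∣? e
      ... | yes p∣e = μ-*-prime-∣ p∣e
      ... | no  p∤e = trans (μ-*-prime-∤ p∤e) (lemma′ (μ e))
        where
        lemma′ : ∀ a → - a ≡ -1ℤ * (1ℤ * a)
        lemma′ = solve-∀

∑-divisors-μ : ∀ n .{{_ : NonZero n}} → sumOver (divisors n) μ ≡ 𝟙 (n ℕₚ.≟ 1)
∑-divisors-μ n with factorise n
-- The empty product forces `n` to be 1, and both sides compute.
... | record { factors = [] ; isFactorisation = refl } = refl
... | record { factors = p ∷ ps ; isFactorisation = refl ; factorsPrime = p-prime ∷ ps-prime } = begin
  sumOver (divisors (p ℕ.* product ps)) μ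
    ≡⟨ cong (λ n → sumOver (divisors n) μ) (ℕₚ.*-comm p (product ps)) ⟩
  sumOver (divisors (product ps ℕ.* p)) μ
    ≡⟨ ∑-divisors-μ-*-prime p-prime (product ps) {{productOfPrimes≢0 ps-prime}} ⟩
  0ℤ
    ≡⟨ 𝟙-false (p ℕ.* product ps ℕₚ.≟ 1) (λ pm≡1 →
         ¬prime[1] (subst Prime (ℕₚ.m*n≡1⇒m≡1 p (product ps) pm≡1) p-prime)) ⟨
  𝟙 (p ℕ.* product ps ℕₚ.≟ 1)  ∎

-- Counting coprime pairs

χ : ℕ → ℕ → ℤ
χ x y = 𝟙 (gcd x y ℕₚ.≟ 1)

χ-comm : ∀ x y → χ x y ≡ χ y x
χ-comm x y = cong (λ g → 𝟙 (g ℕₚ.≟ 1)) (gcd-comm x y)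

-- The common divisors of `x` and `y` are the divisors of `gcd x y`, over which `μ` sums to the
-- indicator of `gcd x y ≡ 1`.
∑-μ-∣≡χ : ∀ x .{{_ : NonZero x}} y → (∑[ d ← divisors x ] (𝟙 (d ∣? y) * μ d)) ≡ χ x y
∑-μ-∣≡χ x y = begin
  (∑[ d ← divisors x ] (𝟙 (d ∣? y) * μ d))
    ≡⟨ ∑-divisors ℕₚ.≤-refl _ ⟨
  (∑[ d ← [1⋯ x ] ] (𝟙 (d ∣? x) * (𝟙 (d ∣? y) * μ d)))
    ≡⟨ ∑-cong [1⋯ x ] (λ {d} _ → common d) ⟩
  (∑[ d ← [1⋯ x ] ] (𝟙 (d ∣? gcd x y) * μ d))
    ≡⟨ ∑-divisors (∣⇒≤ (gcd[m,n]∣m x y)) μ ⟩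
  sumOver (divisors (gcd x y)) μ
    ≡⟨ ∑-divisors-μ (gcd x y) ⟩
  χ x y  ∎
  where
  instance
    g≢0 : NonZero (gcd x y)
    g≢0 = ℕ.≢-nonZero (gcd[m,n]≢0 x y (inj₁ (ℕ.≢-nonZero⁻¹ x)))
  common : ∀ d → 𝟙 (d ∣? x) * (𝟙 (d ∣? y) * μ d) ≡ 𝟙 (d ∣? gcd x y) * μ d
  common d with d ∣? x
  ... | yes d∣x = trans (ℤₚ.*-identityˡ _) (cong (_* μ d)
    (𝟙-cong (d ∣? y) (d ∣? gcd x y) (gcd-greatest d∣x) (λ d∣g → ∣-trans d∣g (gcd[m,n]∣n x y))))
  ... | no  d∤x = sym (cong (_* μ d)
    (𝟙-false (d ∣? gcd x y) (λ d∣g → d∤x (∣-trans d∣g (gcd[m,n]∣m x y)))))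

v-∷ : ∀ x xs d → + v (x ∷ xs) d ≡ 𝟙 (d ∣? x) + + v xs d
v-∷ x xs d with does (d ∣? x)
... | true  = refl
... | false = refl

-- `v xs d` is a sum of indicators over `xs`; exchanging the two sums, by induction on `xs`, leaves
-- one `χ` per entry. This evaluates the inner sum of (c).
∑-μ-v : ∀ x .{{_ : NonZero x}} xs →
        (∑[ d ← divisors x ] (μ d * + v xs d)) ≡ sumOver xs (χ x)
∑-μ-v x []       = ∑-vanish (divisors x) (λ {d} _ → ℤₚ.*-zeroʳ (μ d))
∑-μ-v x (y ∷ xs) = begin
  (∑[ d ← divisors x ] (μ d * + v (y ∷ xs) d))
    ≡⟨ ∑-cong (divisors x) (λ {d} _ →
         trans (cong (μ d *_) (v-∷ y xs d)) (expand (μ d) (𝟙 (d ∣? y)) (+ v xs d))) ⟩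
  (∑[ d ← divisors x ] (𝟙 (d ∣? y) * μ d + μ d * + v xs d))
    ≡⟨ ∑-+ (divisors x) _ _ ⟩
  (∑[ d ← divisors x ] (𝟙 (d ∣? y) * μ d)) + (∑[ d ← divisors x ] (μ d * + v xs d))
    ≡⟨ cong₂ _+_ (∑-μ-∣≡χ x y) (∑-μ-v x xs) ⟩
  χ x y + sumOver xs (χ x)  ∎
  where
  expand : ∀ a b c → a * (b + c) ≡ b * a + a * c
  expand = solve-∀

-- Each entry is compared only with later ones, so every pair of positions is counted once.
coprimePairs : List ℕ → ℤ
coprimePairs []       = 0ℤ
coprimePairs (x ∷ xs) = sumOver xs (χ x) + coprimePairs xs

-- With `e = 𝟙 (d ∣? x)` and `w = v xs d`, `e² = e` gives `(e + w)(e + w - 1) = 2ew + w(w - 1)`; the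
-- cross term counts twice the entries of `xs` coprime to `x`. The bound `N` stays fixed in the
-- induction, whereas the supremum could change with the list.
∑-μ-v[v-1] : ∀ {N xs} → All NonZero xs → All (_≤ N) xs →
  (∑[ d ← [1⋯ N ] ] (μ d * + v xs d * (+ v xs d - 1ℤ))) ≡ + 2 * coprimePairs xs
∑-μ-v[v-1] {N} [] [] = ∑-vanish [1⋯ N ] λ {d} _ → lemma (μ d)
  where
  lemma : ∀ a → a * 0ℤ * -1ℤ ≡ 0ℤ
  lemma = solve-∀
∑-μ-v[v-1] {N} {x ∷ xs} (x≢0 ∷ xs≢0) (x≤N ∷ xs≤N) = begin
  (∑[ d ← [1⋯ N ] ] (μ d * + v (x ∷ xs) d * (+ v (x ∷ xs) d - 1ℤ)))
    ≡⟨ ∑-cong [1⋯ N ] (λ {d} _ → expand d) ⟩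
  (∑[ d ← [1⋯ N ] ] (+ 2 * (𝟙 (d ∣? x) * (μ d * + v xs d)) + μ d * + v xs d * (+ v xs d - 1ℤ)))
    ≡⟨ ∑-+ [1⋯ N ] _ _ ⟩
  (∑[ d ← [1⋯ N ] ] (+ 2 * (𝟙 (d ∣? x) * (μ d * + v xs d)))) +
  (∑[ d ← [1⋯ N ] ] (μ d * + v xs d * (+ v xs d - 1ℤ)))
    ≡⟨ cong₂ _+_ (∑-*ˡ [1⋯ N ] (+ 2) _) (∑-μ-v[v-1] xs≢0 xs≤N) ⟩
  + 2 * (∑[ d ← [1⋯ N ] ] (𝟙 (d ∣? x) * (μ d * + v xs d))) + + 2 * coprimePairs xs
    ≡⟨ cong (λ s → + 2 * s + + 2 * coprimePairs xs)
         (trans (∑-divisors {{x≢0}} x≤N _) (∑-μ-v x {{x≢0}} xs)) ⟩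
  + 2 * sumOver xs (χ x) + + 2 * coprimePairs xs
    ≡⟨ ℤₚ.*-distribˡ-+ (+ 2) (sumOver xs (χ x)) _ ⟨
  + 2 * coprimePairs (x ∷ xs)  ∎
  where
  expand : ∀ d → μ d * + v (x ∷ xs) d * (+ v (x ∷ xs) d - 1ℤ) ≡
           + 2 * (𝟙 (d ∣? x) * (μ d * + v xs d)) + μ d * + v xs d * (+ v xs d - 1ℤ)
  expand d = begin
    μ d * + v (x ∷ xs) d * (+ v (x ∷ xs) d - 1ℤ)
      ≡⟨ cong (λ w → μ d * w * (w - 1ℤ)) (v-∷ x xs d) ⟩
    μ d * (e + w) * (e + w - 1ℤ)
      ≡⟨ expand₁ (μ d) e w ⟩
    μ d * (e * e) - μ d * e + (+ 2 * (e * (μ d * w)) + μ d * w * (w - 1ℤ))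
      ≡⟨ cong (λ e² → μ d * e² - μ d * e + (+ 2 * (e * (μ d * w)) + μ d * w * (w - 1ℤ)))
           (𝟙-idem (d ∣? x)) ⟩
    μ d * e - μ d * e + (+ 2 * (e * (μ d * w)) + μ d * w * (w - 1ℤ))
      ≡⟨ cancel (μ d * e) _ ⟩
    + 2 * (e * (μ d * w)) + μ d * w * (w - 1ℤ)  ∎
    where
    e = 𝟙 (d ∣? x)
    w = + v xs d
    expand₁ : ∀ m e w → m * (e + w) * (e + w - 1ℤ) ≡
                        m * (e * e) - m * e + (+ 2 * (e * (m * w)) + m * w * (w - 1ℤ))
    expand₁ = solve-∀
    cancel : ∀ a b → a - a + b ≡ b
    cancel = solve-∀

-- The left side compares each entry with earlier ones, `coprimePairs` with later ones. Removing the
-- pairs that involve `b zero` from both gives the induction.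
coprimePairs-tabulate : ∀ {k} (b : Fin k → ℕ) →
  (∑[ i ← allFin k ] sumOver (take (toℕ i) (tabulate b)) (χ (b i))) ≡ coprimePairs (tabulate b)
coprimePairs-tabulate {zero}  b = refl
coprimePairs-tabulate {suc k} b = begin
  0ℤ + (∑[ i ← tabulate suc ] earlier b i)
    ≡⟨ ℤₚ.+-identityˡ _ ⟩
  (∑[ i ← tabulate suc ] earlier b i)
    -- For an index `suc i` the initial segment begins with `b zero`, so `earlier b (suc i)` unfolds
    -- to the summand displayed next.
    ≡⟨ ∑-tabulate suc (earlier b) ⟩
  (∑[ i ← allFin k ] (χ (b (suc i)) (b zero) + earlier (b ∘ suc) i))
    ≡⟨ ∑-+ (allFin k) _ _ ⟩
  (∑[ i ← allFin k ] χ (b (suc i)) (b zero)) + (∑[ i ← allFin k ] earlier (b ∘ suc) i)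
    ≡⟨ cong₂ _+_ (∑-cong (allFin k) (λ {i} _ → χ-comm (b (suc i)) (b zero)))
                 (coprimePairs-tabulate (b ∘ suc)) ⟩
  (∑[ i ← allFin k ] χ (b zero) (b (suc i))) + coprimePairs (tabulate (b ∘ suc))
    ≡⟨ cong (λ s → s + coprimePairs (tabulate (b ∘ suc))) (∑-tabulate (b ∘ suc) (χ (b zero))) ⟨
  coprimePairs (tabulate b)  ∎
  where
  earlier : ∀ {k} (b : Fin k → ℕ) → Fin k → ℤ
  earlier b i = sumOver (take (toℕ i) (tabulate b)) (χ (b i))

-- Comparison with the number of all pairs

CoprimeTo : ℕ → ℕ → Set
CoprimeTo x y = gcd x y ≡ 1

-- Counted in `ℕ`, where a sum vanishes only if every summand does.
noncoprimeTo : ℕ → List ℕ → ℕ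
noncoprimeTo x xs = length (filter (λ y → ¬? (gcd x y ℕₚ.≟ 1)) xs)

noncoprimePairs : List ℕ → ℕ
noncoprimePairs []       = 0
noncoprimePairs (x ∷ xs) = noncoprimeTo x xs ℕ.+ noncoprimePairs xs

∑χ+noncoprimeTo : ∀ x xs → sumOver xs (χ x) + + noncoprimeTo x xs ≡ + length xs
∑χ+noncoprimeTo x []       = refl
∑χ+noncoprimeTo x (y ∷ xs) with does (gcd x y ℕₚ.≟ 1)
... | true  = trans (ℤₚ.+-assoc 1ℤ (sumOver xs (χ x)) _) (cong (_+_ 1ℤ) (∑χ+noncoprimeTo x xs))
... | false = trans (lemma (sumOver xs (χ x)) (+ noncoprimeTo x xs))
                    (cong (_+_ 1ℤ) (∑χ+noncoprimeTo x xs))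
  where
  lemma : ∀ a b → 0ℤ + a + (1ℤ + b) ≡ 1ℤ + (a + b)
  lemma = solve-∀

-- Adding an entry to a list of length `l` raises the square by `8l`, and creates `l` new pairs,
-- each coprime or not. The induction avoids halving `k(k-1)`.
[2∣X∣-1]² : ∀ xs → (+ 2 * + length xs - 1ℤ) * (+ 2 * + length xs - 1ℤ) ≡
                   1ℤ + + 8 * (coprimePairs xs + + noncoprimePairs xs)
[2∣X∣-1]² []       = refl
[2∣X∣-1]² (x ∷ xs) = begin
  (+ 2 * (1ℤ + l) - 1ℤ) * (+ 2 * (1ℤ + l) - 1ℤ)
    ≡⟨ step l ⟩
  (+ 2 * l - 1ℤ) * (+ 2 * l - 1ℤ) + + 8 * l
    ≡⟨ cong₂ (λ a b → a + + 8 * b) ([2∣X∣-1]² xs) (sym (∑χ+noncoprimeTo x xs)) ⟩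
  1ℤ + + 8 * (coprimePairs xs + q) + + 8 * (sumOver xs (χ x) + t)
    ≡⟨ regroup (coprimePairs xs) q (sumOver xs (χ x)) t ⟩
  1ℤ + + 8 * (coprimePairs (x ∷ xs) + (t + q))  ∎
  where
  l = + length xs
  q = + noncoprimePairs xs
  t = + noncoprimeTo x xs
  step : ∀ l → (+ 2 * (1ℤ + l) - 1ℤ) * (+ 2 * (1ℤ + l) - 1ℤ) ≡
               (+ 2 * l - 1ℤ) * (+ 2 * l - 1ℤ) + + 8 * l
  step = solve-∀
  regroup : ∀ p q s t → 1ℤ + + 8 * (p + q) + + 8 * (s + t) ≡ 1ℤ + + 8 * (s + p + (t + q))
  regroup = solve-∀

noncoprimeTo≡0⇒All : ∀ x xs → noncoprimeTo x xs ≡ 0 → All (CoprimeTo x) xs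
noncoprimeTo≡0⇒All x xs eq = All.tabulate λ {y} y∈ → decidable-stable (gcd x y ℕₚ.≟ 1)
  λ ¬c → ℕₚ.>⇒≢ (∈-length (∈-filter⁺ (λ y → ¬? (gcd x y ℕₚ.≟ 1)) y∈ ¬c)) eq

All⇒noncoprimeTo≡0 : ∀ x {xs} → All (CoprimeTo x) xs → noncoprimeTo x xs ≡ 0
All⇒noncoprimeTo≡0 x all = cong length (filter-none _ (All.map contradiction all))

noncoprimePairs≡0⇒AllPairs : ∀ xs → noncoprimePairs xs ≡ 0 → AllPairs CoprimeTo xs
noncoprimePairs≡0⇒AllPairs []       _  = []
noncoprimePairs≡0⇒AllPairs (x ∷ xs) eq =
  noncoprimeTo≡0⇒All x xs (ℕₚ.m+n≡0⇒m≡0 _ eq) ∷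
  noncoprimePairs≡0⇒AllPairs xs (ℕₚ.m+n≡0⇒n≡0 (noncoprimeTo x xs) eq)

AllPairs⇒noncoprimePairs≡0 : ∀ {xs} → AllPairs CoprimeTo xs → noncoprimePairs xs ≡ 0
AllPairs⇒noncoprimePairs≡0 []                 = refl
AllPairs⇒noncoprimePairs≡0 {x ∷ _} (px ∷ pxs) =
  cong₂ ℕ._+_ (All⇒noncoprimeTo≡0 x px) (AllPairs⇒noncoprimePairs≡0 pxs)

-- The two sides of the root equation differ, once squared, by eight times the number of non-coprime
-- pairs. `S` is kept general so as to serve both (b) and (c).
AllPairs⇔√ : ∀ xs {S} → 1 ≤ length xs → S ≡ + 8 * coprimePairs xs →
             AllPairs CoprimeTo xs ⇔ (+ 2 * + length xs - 1ℤ ≡√ 1ℤ + S)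
AllPairs⇔√ xs@(_ ∷ _) _ refl = mk⇔ to from
  where
  y = + 2 * + length xs - 1ℤ
  C = coprimePairs xs

  to : AllPairs CoprimeTo xs → y ≡√ 1ℤ + + 8 * C
  -- Since `xs` is nonempty, `y` computes to a nonnegative integer; for an empty list it would be
  -- -1.
  to ps = +≤+ z≤n , (begin
    y * y                                 ≡⟨ [2∣X∣-1]² xs ⟩
    1ℤ + + 8 * (C + + noncoprimePairs xs) ≡⟨ cong (λ q → 1ℤ + + 8 * (C + + q))
                                                (AllPairs⇒noncoprimePairs≡0 ps) ⟩
    1ℤ + + 8 * (C + 0ℤ)                   ≡⟨ cong (λ c → 1ℤ + + 8 * c) (ℤₚ.+-identityʳ C) ⟩
    1ℤ + + 8 * C                          ∎)

  from : y ≡√ 1ℤ + + 8 * C → AllPairs CoprimeTo xs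
  -- Cancelling 1, 8 and `C` between the two expressions for `y * y` leaves `0ℤ` equal to the
  -- non-coprime count.
  from (_ , y²≡) = noncoprimePairs≡0⇒AllPairs xs (ℤₚ.+-injective
    (sym (+-cancelˡ C 0ℤ _ (trans (ℤₚ.+-identityʳ C)
      (ℤₚ.*-cancelˡ-≡ (+ 8) C _ (+-cancelˡ 1ℤ _ _ (trans (sym y²≡) ([2∣X∣-1]² xs))))))))

-- From lists to sets, and the two equivalences

AllPairs⇒PairwiseCoprime : ∀ {xs} → AllPairs CoprimeTo xs → PairwiseCoprime xs
AllPairs⇒PairwiseCoprime (px ∷ _)  (here refl) (here refl) x≢x = contradiction refl x≢x
AllPairs⇒PairwiseCoprime (px ∷ _)  (here refl) (there y∈)  _   = All.lookup px y∈
-- `AllPairs` knows only the list order; the reverse order comes from the symmetry of `gcd`.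
AllPairs⇒PairwiseCoprime (py ∷ _) {x} {y} (there x∈) (here refl) _ =
  trans (gcd-comm x y) (All.lookup py x∈)
AllPairs⇒PairwiseCoprime (_ ∷ pxs) (there x∈)  (there y∈)  x≢y =
  AllPairs⇒PairwiseCoprime pxs x∈ y∈ x≢y

module _ {k : ℕ} (1≤k : 1 ≤ k) {a b : Fin k → ℕ} (b-injective : Injective _≡_ _≡_ b)
         (a⊆b : ∀ {x} → x ∈ tabulate a → x ∈ tabulate b)
         (b⊆a : ∀ {x} → x ∈ tabulate b → x ∈ tabulate a) where

  -- Pairwise coprimality depends only on the set, so it passes between two enumerations: `b` is `a`
  -- itself for (b) and `a` reordered by `τ` for (c).
  PairwiseCoprime⇔√ : ∀ {S} → S ≡ + 8 * coprimePairs (tabulate b) →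
    PairwiseCoprime (tabulate a) ⇔ (+ 2 * + ∣ tabulate a ∣ - 1ℤ ≡√ 1ℤ + S)
  PairwiseCoprime⇔√ S≡ rewrite trans (length-tabulate a) (sym (length-tabulate b)) = mk⇔
    -- Injectivity makes entries at different positions different, as `pc` demands.
    (λ (pc : PairwiseCoprime (tabulate a)) → to (AllPairs.tabulate⁺ λ {i} {j} i≢j →
      pc (b⊆a (∈-tabulate⁺ i)) (b⊆a (∈-tabulate⁺ j)) (i≢j ∘ b-injective)))
    (λ eq x∈ y∈ → AllPairs⇒PairwiseCoprime (from eq) (a⊆b x∈) (a⊆b y∈))
    where
    open Equivalence
      (AllPairs⇔√ (tabulate b) (subst (1 ≤_) (sym (length-tabulate b)) 1≤k) S≡) using (to; from)

theorem5p5 : (k : ℕ) → 1 ≤ k →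
    (a : Fin k → ℕ) → (∀ i → 0 < a i) → Injective _≡_ _≡_ a →
    (τ : Permutation′ k) →
    let A = setOf a in
    (PairwiseCoprime A ⇔
    (+ 2 * + ∣ A ∣ - 1ℤ ≡√
    1ℤ + + 4 * (∑[ d ← [1⋯ sup A ] ] (μ d * + v A d * (+ v A d - 1ℤ)))))
    ×
    (PairwiseCoprime A ⇔
    (+ 2 * + ∣ A ∣ - 1ℤ ≡√
    1ℤ + + 8 * (∑[ i ← allFin k ] ∑[ d ← divisors (a (τ ⟨$⟩ʳ i)) ]
    (μ d * + v (prefix a τ (toℕ i)) d))))
theorem5p5 k 1≤k a a>0 a-injective τ =
    PairwiseCoprime⇔√ 1≤k a-injective id id
      -- The factor 8 is 4 times the 2 from counting each pair twice.
      (trans (cong (+ 4 *_) (∑-μ-v[v-1] (All.tabulate⁺ a≢0) (xs≤max 0 (setOf a))))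
             (sym (ℤₚ.*-assoc (+ 4) (+ 2) _)))
  , PairwiseCoprime⇔√ 1≤k b-injective a⊆b b⊆a
      (cong (+ 8 *_) (trans
        -- `prefix a τ (toℕ i)` unfolds to the entries of `b` before position `i`.
        (∑-cong (allFin k) λ {i} _ → ∑-μ-v (b i) {{a≢0 (τ ⟨$⟩ʳ i)}} (prefix a τ (toℕ i)))
        (coprimePairs-tabulate b)))
  where
  a≢0 : ∀ i → NonZero (a i)
  a≢0 i = >-nonZero (a>0 i)

  b : Fin k → ℕ
  b = a ∘ (τ ⟨$⟩ʳ_)

  b-injective : Injective _≡_ _≡_ b
  b-injective eq = trans (sym (inverseˡ τ))
    (trans (cong (τ ⟨$⟩ˡ_) (a-injective eq)) (inverseˡ τ))

  a⊆b : ∀ {x} → x ∈ tabulate a → x ∈ tabulate b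
  a⊆b x∈ with i , refl ← ∈-tabulate⁻ x∈ =
    subst (λ j → a j ∈ tabulate b) (inverseʳ τ) (∈-tabulate⁺ {f = b} (τ ⟨$⟩ˡ i))

  b⊆a : ∀ {x} → x ∈ tabulate b → x ∈ tabulate a
  b⊆a x∈ with i , refl ← ∈-tabulate⁻ x∈ = ∈-tabulate⁺ {f = a} (τ ⟨$⟩ʳ i)
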